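{- Let $G=(V,E)$ be a finite simple vertex-transitive graph of order $n$ and let $v\in V$. Then for every integer $i$ with $1\le i\le n$, $$d_t(G,i)=\frac{n}{i}\,d_t^v(G,i).$$
   Context: For a finite simple graph $G=(V,E)$, a set $D\subseteq V$ is a total dominating set if every vertex of $V$ is adjacent to some vertex of $D$. $d_t(G,i)$ is the number of total dominating sets of $G$ of cardinality $i$, and $d_t^v(G,i)$ is the number of total dominating sets of $G$ of cardinality $i$ that contain the vertex $v$. -}

module Defs where

open import Data.Fin.Base using (Fin)
open import Data.Fin.Permutation using (Permutation′; _⟨$⟩ʳ_)
open import Data.Fin.Properties using (all?; any?)
open import Data.Fin.Subset using (Subset; inside; outside; _∈_; ∣_∣)
open import Data.Fin.Subset.Properties using (_∈?_)
open import Data.List.Base using (List; []; _∷_; _++_; map; filter; length)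
open import Data.List.Membership.Propositional using () renaming (_∈_ to _∈ₗ_)
open import Data.List.Membership.Propositional.Properties
  using (∈-map⁺; ∈-map⁻; ∈-++⁺ˡ; ∈-++⁺ʳ)
open import Data.List.Relation.Unary.Any using (here)
open import Data.List.Relation.Unary.Unique.Propositional using (Unique; []; _∷_)
open import Data.List.Relation.Unary.Unique.Propositional.Properties
  using (map⁺; ++⁺)
import Data.List.Relation.Unary.All as All
open import Data.Nat.Base using (ℕ; zero; suc)
open import Data.Nat.Properties using (_≟_)
import Data.Vec.Base as Vec
open import Data.Vec.Properties using (∷-injectiveʳ)
open import Data.Product.Base using (_×_; ∃; _,_)
open import Function.Bundles using (_⇔_)
open import Level using (0ℓ)
open import Relation.Binary.Core using (Rel)
open import Relation.Binary.Definitions using (Symmetric; Decidable)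
open import Relation.Binary.PropositionalEquality using (_≡_; refl)
open import Relation.Nullary using (¬_; Dec)
open import Relation.Nullary.Decidable using (_×-dec_)

-- A finite simple graph of order n, with vertex set Fin n.  Adjacency is
-- decidable so that families of vertex subsets can be counted.
record Graph (n : ℕ) : Set₁ where
  field
    Adj        : Rel (Fin n) 0ℓ
    adj?       : Decidable Adj
    adj-sym    : Symmetric Adj
    adj-irrefl : ∀ {u} → ¬ Adj u u

open Graph public

IsAutomorphism : ∀ {n} → Graph n → Permutation′ n → Set
IsAutomorphism G φ = ∀ u w → Adj G u w ⇔ Adj G (φ ⟨$⟩ʳ u) (φ ⟨$⟩ʳ w)

VertexTransitive : ∀ {n} → Graph n → Set
VertexTransitive {n} G =
  ∀ (u w : Fin n) → ∃ λ φ → IsAutomorphism G φ × φ ⟨$⟩ʳ u ≡ w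

IsTotalDominating : ∀ {n} → Graph n → Subset n → Set
IsTotalDominating G D = ∀ u → ∃ λ w → w ∈ D × Adj G u w

isTotalDominating? : ∀ {n} (G : Graph n) (D : Subset n) →
                     Dec (IsTotalDominating G D)
isTotalDominating? G D = all? λ u → any? λ w → (w ∈? D) ×-dec adj? G u w

subsets : ∀ n → List (Subset n)
subsets zero    = Vec.[] ∷ []
subsets (suc n) = map (inside Vec.∷_) (subsets n) ++ map (outside Vec.∷_) (subsets n)

-- Every subset occurs in the enumeration, and only once, so the length of
-- a filtered enumeration is the number of subsets with the given property.
∈-subsets : ∀ {n} (D : Subset n) → D ∈ₗ subsets n
∈-subsets Vec.[] = here refl
∈-subsets (inside Vec.∷ D) = ∈-++⁺ˡ (∈-map⁺ (inside Vec.∷_) (∈-subsets D))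
∈-subsets {suc n} (outside Vec.∷ D) =
  ∈-++⁺ʳ (map (inside Vec.∷_) (subsets n)) (∈-map⁺ (outside Vec.∷_) (∈-subsets D))

subsets-unique : ∀ n → Unique (subsets n)
subsets-unique zero    = All.[] ∷ []
subsets-unique (suc n) =
  ++⁺ (map⁺ ∷-injectiveʳ (subsets-unique n)) (map⁺ ∷-injectiveʳ (subsets-unique n))
      λ (p , q) → disjoint (∈-map⁻ _ p) (∈-map⁻ _ q)
  where
  disjoint : ∀ {D : Subset (suc n)} →
             ∃ (λ A → A ∈ₗ subsets n × D ≡ inside Vec.∷ A) →
             ¬ ∃ (λ B → B ∈ₗ subsets n × D ≡ outside Vec.∷ B)
  disjoint (_ , _ , refl) (_ , _ , ())

dₜ : ∀ {n} → Graph n → ℕ → ℕ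
dₜ {n} G i =
  length (filter (λ D → isTotalDominating? G D ×-dec (∣ D ∣ ≟ i)) (subsets n))

-- dₜ∋ G v i counts the total dominating sets of size i that contain v.
dₜ∋ : ∀ {n} → Graph n → Fin n → ℕ → ℕ
dₜ∋ {n} G v i =
  length (filter (λ D → isTotalDominating? G D ×-dec (∣ D ∣ ≟ i) ×-dec (v ∈? D))
                 (subsets n))

-- Count the pairs (w , D) with D a total dominating set of size i and w ∈ D.
-- Grouped by D they number i · dₜ(G,i); grouped by w they number n · dₜ∋(G,v,i),
-- because automorphisms permute the total dominating sets of size i, so that
-- by vertex-transitivity the number of those through w does not depend on w.

{-# OPTIONS --safe #-}
module Submission where

open import Defs
open import Data.Bool.Base using (Bool; true; false; if_then_else_)
open import Data.Fin.Base using (Fin; zero; suc)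
open import Data.Fin.Permutation
  using (Permutation′; _⟨$⟩ʳ_; _⟨$⟩ˡ_; inverseˡ; inverseʳ)
open import Data.Fin.Properties using (injective⇒≤)
open import Data.Fin.Subset using (Subset; inside; outside; _∈_; ∣_∣)
open import Data.Fin.Subset.Properties using (_∈?_)
open import Data.Integer.Base as ℤ using (+_)
import Data.Integer.Properties as ℤ
open import Data.List.Base as List using (List; []; _∷_; filter; length)
open import Data.List.Membership.Propositional using () renaming (_∈_ to _∈ₗ_)
open import Data.List.Membership.Propositional.Properties
  using (∈-map⁻; ∈-filter⁺; ∈-filter⁻; ∈-lookup)
open import Data.List.Membership.Setoid.Properties using (index-injective)
open import Data.List.Properties using (length-map)
import Data.List.Relation.Unary.All as All
open import Data.List.Relation.Unary.Any using (index)
open import Data.List.Relation.Unary.Unique.Propositional using (Unique; []; _∷_)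
import Data.List.Relation.Unary.Unique.Propositional.Properties as Unique
open import Data.Nat.Base as ℕ using (ℕ; zero; suc; _≤_; >-nonZero)
open import Data.Nat.Properties
  using (_≟_; +-0-commutativeMonoid; ≤-antisym; module ≤-Reasoning)
import Data.Nat.Properties as ℕ
open import Data.Product.Base using (_,_)
open import Data.Rational.Base using (_/_; _*_; toℚᵘ)
open import Data.Rational.Properties
  using (toℚᵘ-injective; toℚᵘ-fromℚᵘ; toℚᵘ-homo-*)
open import Data.Rational.Unnormalised.Base as ℚᵘ using (mkℚᵘ; *≡*)
import Data.Rational.Unnormalised.Properties as ℚᵘ
open import Data.Vec.Base using ([]; _∷_; lookup; tabulate)
open import Data.Vec.Properties
  using (lookup∘tabulate; tabulate∘lookup; tabulate-cong; []=⇒lookup; lookup⇒[]=)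
open import Function.Base using (_∘_; id)
open import Function.Bundles using (Equivalence)
open import Function.Definitions using (Injective)
open import Relation.Binary.PropositionalEquality
  using (_≡_; refl; sym; trans; cong; cong₂; subst; setoid; module ≡-Reasoning)
open import Relation.Nullary.Decidable using (yes; no; does; _×-dec_)
open import Relation.Nullary.Negation using (contradiction)
open import Relation.Unary using (Pred; Decidable)
open import Algebra.Properties.CommutativeMonoid.Sum +-0-commutativeMonoid
  using (sum-syntax; sum-cong-≗; ∑-distrib-+; ∑-permute)

indicator : Bool → ℕ
indicator b = if b then 1 else 0

∑-const : ∀ n c → ∑[ j < n ] c ≡ n ℕ.* c
∑-const zero    c = refl
∑-const (suc n) c = cong (c ℕ.+_) (∑-const n c)

module _ {a} {A : Set a} where

  lookup-injective : ∀ {xs : List A} → Unique xs → Injective _≡_ _≡_ (List.lookup xs)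
  lookup-injective (x∉xs ∷ uxs) {zero}  {zero}  eq = refl
  lookup-injective (x∉xs ∷ uxs) {zero}  {suc j} eq =
    contradiction eq (All.lookup x∉xs (∈-lookup j))
  lookup-injective (x∉xs ∷ uxs) {suc i} {zero}  eq =
    contradiction (sym eq) (All.lookup x∉xs (∈-lookup i))
  lookup-injective (x∉xs ∷ uxs) {suc i} {suc j} eq =
    cong suc (lookup-injective uxs eq)

  -- Sending each position of `xs` to the position of the same entry in `ys` is injective, because
  -- `xs` has no repetitions; the pigeonhole principle on `Fin` then bounds the lengths.
  unique-⊆⇒length≤ : ∀ {xs ys : List A} → Unique xs →
                     (∀ {x} → x ∈ₗ xs → x ∈ₗ ys) → length xs ≤ length ys
  unique-⊆⇒length≤ uxs xs⊆ys = injective⇒≤ {f = λ i → index (xs⊆ys (∈-lookup i))}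
    λ eq → lookup-injective uxs (index-injective (setoid A) (xs⊆ys _) (xs⊆ys _) eq)

  length-filter-∷ : ∀ {p} {P : Pred A p} (P? : Decidable P) x xs →
    length (filter P? (x ∷ xs)) ≡ indicator (does (P? x)) ℕ.+ length (filter P? xs)
  length-filter-∷ P? x xs with does (P? x)
  ... | true  = refl
  ... | false = refl

-- The values of `f` on the subsets satisfying `P` form a list without repetitions. Each of them
-- satisfies `Q` and occurs in the full enumeration, so the order in which `f` rearranges subsets is
-- irrelevant.
length-filter-subsets-≤ : ∀ {n p q} {P : Pred (Subset n) p} {Q : Pred (Subset n) q}
  (P? : Decidable P) (Q? : Decidable Q) (f : Subset n → Subset n) →
  Injective _≡_ _≡_ f → (∀ {D} → P D → Q (f D)) →
  length (filter P? (subsets n)) ≤ length (filter Q? (subsets n))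
length-filter-subsets-≤ {n} P? Q? f f-inj P⇒Q∘f = begin
  length (filter P? (subsets n))               ≡⟨ length-map f (filter P? (subsets n)) ⟨
  length (List.map f (filter P? (subsets n)))  ≤⟨ unique-⊆⇒length≤ unique included ⟩
  length (filter Q? (subsets n))               ∎
  where
  open ≤-Reasoning
  unique : Unique (List.map f (filter P? (subsets n)))
  unique = Unique.map⁺ f-inj (Unique.filter⁺ P? (subsets-unique n))
  included : ∀ {D} → D ∈ₗ List.map f (filter P? (subsets n)) → D ∈ₗ filter Q? (subsets n)
  included D∈ with ∈-map⁻ f D∈
  ... | C , C∈ , refl with ∈-filter⁻ P? {xs = subsets n} C∈
  ...   | _ , PC = ∈-filter⁺ Q? (∈-subsets (f C)) (P⇒Q∘f PC)

does-∈? : ∀ {n} (v : Fin n) (D : Subset n) → does (v ∈? D) ≡ lookup D v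
does-∈? zero    (inside  ∷ D) = refl
does-∈? zero    (outside ∷ D) = refl
does-∈? (suc v) (_       ∷ D) = does-∈? v D

∣D∣≡∑ : ∀ {n} (D : Subset n) → ∣ D ∣ ≡ ∑[ v < n ] indicator (lookup D v)
∣D∣≡∑ []            = refl
∣D∣≡∑ (inside  ∷ D) = cong suc (∣D∣≡∑ D)
∣D∣≡∑ (outside ∷ D) = ∣D∣≡∑ D

-- Q stands for ∣ D ∣ ≡ i: since does (∣ D ∣ ≟ i) computes to ∣ D ∣ ≡ᵇ i, a with on
-- ∣ D ∣ ≟ i itself would not abstract it from the goal.
∑-length-filter-∈ : ∀ {n p q} {P : Pred (Subset n) p} {Q : Pred (Subset n) q}
  (P? : Decidable P) (Q? : Decidable Q) i → (∀ {D} → Q D → ∣ D ∣ ≡ i) → ∀ Ds →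
  ∑[ v < n ] length (filter (λ D → P? D ×-dec Q? D ×-dec (v ∈? D)) Ds) ≡
  length (filter (λ D → P? D ×-dec Q? D) Ds) ℕ.* i
∑-length-filter-∈ {n} P? Q? i Q⇒size [] = trans (∑-const n 0) (ℕ.*-zeroʳ n)
∑-length-filter-∈ {n} P? Q? i Q⇒size (D ∷ Ds) = begin
  ∑[ v < n ] length (filter (through? v) (D ∷ Ds))
    ≡⟨ sum-cong-≗ (λ v → length-filter-∷ (through? v) D Ds) ⟩
  ∑[ v < n ] (indicator (does (through? v D)) ℕ.+ length (filter (through? v) Ds))
    ≡⟨ ∑-distrib-+ (λ v → indicator (does (through? v D))) _ ⟩
  ∑[ v < n ] indicator (does (through? v D)) ℕ.+ ∑[ v < n ] length (filter (through? v) Ds)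
    ≡⟨ cong₂ ℕ._+_ pointwise (∑-length-filter-∈ P? Q? i Q⇒size Ds) ⟩
  indicator (does (both? D)) ℕ.* i ℕ.+ length (filter both? Ds) ℕ.* i
    ≡⟨ ℕ.*-distribʳ-+ i (indicator (does (both? D))) _ ⟨
  (indicator (does (both? D)) ℕ.+ length (filter both? Ds)) ℕ.* i
    ≡⟨ cong (ℕ._* i) (length-filter-∷ both? D Ds) ⟨
  length (filter both? (D ∷ Ds)) ℕ.* i ∎
  where
  open ≡-Reasoning
  both? = λ C → P? C ×-dec Q? C
  through? = λ v C → P? C ×-dec Q? C ×-dec (v ∈? C)

  -- The set `D` is counted once for each of its elements if it has both properties, hence `i` times
  -- in all, and never otherwise.
  pointwise : ∑[ v < n ] indicator (does (through? v D)) ≡ indicator (does (both? D)) ℕ.* i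
  pointwise with P? D | Q? D
  ... | no  _ | _        = trans (∑-const n 0) (ℕ.*-zeroʳ n)
  ... | yes _ | no  _  = trans (∑-const n 0) (ℕ.*-zeroʳ n)
  ... | yes _ | yes QD = begin
    ∑[ v < n ] indicator (does (v ∈? D)) ≡⟨ sum-cong-≗ (λ v → cong indicator (does-∈? v D)) ⟩
    ∑[ v < n ] indicator (lookup D v)    ≡⟨ ∣D∣≡∑ D ⟨
    ∣ D ∣                                ≡⟨ Q⇒size QD ⟩
    i                                    ≡⟨ ℕ.*-identityˡ i ⟨
    1 ℕ.* i                              ∎

-- The direct image of `D` as a characteristic vector: `u` belongs to it exactly when its preimage
-- under `φ` belongs to `D`, hence the inverse `⟨$⟩ˡ`.
image : ∀ {n} → Permutation′ n → Subset n → Subset n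
image φ D = tabulate λ u → lookup D (φ ⟨$⟩ˡ u)

module _ {n} (φ : Permutation′ n) where

  lookup-image : ∀ D u → lookup (image φ D) (φ ⟨$⟩ʳ u) ≡ lookup D u
  lookup-image D u = trans (lookup∘tabulate _ (φ ⟨$⟩ʳ u)) (cong (lookup D) (inverseˡ φ))

  image-injective : Injective _≡_ _≡_ (image φ)
  image-injective {C} {D} eq = begin
    C                                             ≡⟨ preimage C ⟨
    tabulate (lookup (image φ C) ∘ (φ ⟨$⟩ʳ_))     ≡⟨ cong (λ B → tabulate (lookup B ∘ (φ ⟨$⟩ʳ_))) eq ⟩
    tabulate (lookup (image φ D) ∘ (φ ⟨$⟩ʳ_))     ≡⟨ preimage D ⟩
    D                                             ∎
    where
    open ≡-Reasoning
    -- Pulling the image back along `φ` returns `B`, so `image φ` has a left inverse.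
    preimage : ∀ B → tabulate (lookup (image φ B) ∘ (φ ⟨$⟩ʳ_)) ≡ B
    preimage B = trans (tabulate-cong (lookup-image B)) (tabulate∘lookup B)

  ∈-image : ∀ {D u} → u ∈ D → φ ⟨$⟩ʳ u ∈ image φ D
  ∈-image {D} {u} u∈D = lookup⇒[]= _ _ (trans (lookup-image D u) ([]=⇒lookup u∈D))

  -- The size is a sum of indicators over all vertices, and reindexing that sum by `φ` does not
  -- change it.
  ∣image∣ : ∀ D → ∣ image φ D ∣ ≡ ∣ D ∣
  ∣image∣ D = begin
    ∣ image φ D ∣                                          ≡⟨ ∣D∣≡∑ (image φ D) ⟩
    ∑[ u < n ] indicator (lookup (image φ D) u)            ≡⟨ ∑-permute (indicator ∘ lookup (image φ D)) φ ⟩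
    ∑[ u < n ] indicator (lookup (image φ D) (φ ⟨$⟩ʳ u))   ≡⟨ sum-cong-≗ (cong indicator ∘ lookup-image D) ⟩
    ∑[ u < n ] indicator (lookup D u)                      ≡⟨ ∣D∣≡∑ D ⟨
    ∣ D ∣                                                  ∎
    where open ≡-Reasoning

  -- A neighbour in `D` of the preimage of `u` is carried by `φ` to a neighbour of `u` in the image.
  image-isTotalDominating : ∀ G → IsAutomorphism G φ →
    ∀ {D} → IsTotalDominating G D → IsTotalDominating G (image φ D)
  image-isTotalDominating G aut td u with td (φ ⟨$⟩ˡ u)
  ... | w , w∈D , adj = φ ⟨$⟩ʳ w , ∈-image w∈D ,
    subst (λ x → Adj G x (φ ⟨$⟩ʳ w)) (inverseʳ φ) (Equivalence.to (aut (φ ⟨$⟩ˡ u) w) adj)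

module _ {n} (G : Graph n) (transitive : VertexTransitive G) where

  -- An automorphism taking `v` to `w` injects the sets counted at `v` into those counted at `w`.
  -- One inequality is enough: exchanging `v` and `w` gives the other.
  dₜ∋-≤ : ∀ v w i → dₜ∋ G v i ≤ dₜ∋ G w i
  dₜ∋-≤ v w i with transitive v w
  ... | φ , aut , refl = length-filter-subsets-≤ _ _ (image φ) (image-injective φ)
    λ {D} (td , size , v∈D) →
      image-isTotalDominating φ G aut td , trans (∣image∣ φ D) size , ∈-image φ v∈D

  dₜ*i≡n*dₜ∋ : ∀ v i → dₜ G i ℕ.* i ≡ n ℕ.* dₜ∋ G v i
  dₜ*i≡n*dₜ∋ v i = begin
    dₜ G i ℕ.* i           ≡⟨ ∑-length-filter-∈ (isTotalDominating? G) (λ D → ∣ D ∣ ≟ i) i id (subsets n) ⟨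
    ∑[ w < n ] dₜ∋ G w i   ≡⟨ sum-cong-≗ (λ w → ≤-antisym (dₜ∋-≤ w v i) (dₜ∋-≤ v w i)) ⟩
    ∑[ w < n ] dₜ∋ G v i   ≡⟨ ∑-const n (dₜ∋ G v i) ⟩
    n ℕ.* dₜ∋ G v i        ∎
    where open ≡-Reasoning

-- The equation is checked in the unnormalised rationals, where equality is cross-multiplication and
-- no reduction by a gcd intervenes. There `mkℚᵘ` takes the denominator minus one, so `k` stands for
-- `i` and `0` for 1.
a*i≡n*b⇒a≡n/i*b : ∀ a b n i .{{_ : ℕ.NonZero i}} → a ℕ.* i ≡ n ℕ.* b →
  (+ a) / 1 ≡ (+ n) / i * ((+ b) / 1)
a*i≡n*b⇒a≡n/i*b a b n i@(suc k) eq = toℚᵘ-injective (begin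
  toℚᵘ ((+ a) / 1)                         ≈⟨ toℚᵘ-fromℚᵘ (mkℚᵘ (+ a) 0) ⟩
  mkℚᵘ (+ a) 0                             ≈⟨ *≡* cross ⟩
  mkℚᵘ (+ n) k ℚᵘ.* mkℚᵘ (+ b) 0           ≈⟨ ℚᵘ.*-cong (toℚᵘ-fromℚᵘ (mkℚᵘ (+ n) k)) (toℚᵘ-fromℚᵘ (mkℚᵘ (+ b) 0)) ⟨
  toℚᵘ ((+ n) / i) ℚᵘ.* toℚᵘ ((+ b) / 1)   ≈⟨ toℚᵘ-homo-* ((+ n) / i) ((+ b) / 1) ⟨
  toℚᵘ ((+ n) / i * ((+ b) / 1))           ∎)
  where
  open ℚᵘ.≃-Reasoning
  -- The factor `i ℕ.* 1` is the denominator of the product on the right, and the final `+ 1` is the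
  -- denominator of `a`.
  cross : + a ℤ.* + (i ℕ.* 1) ≡ + n ℤ.* + b ℤ.* + 1
  cross = trans (cong (λ m → + a ℤ.* + m) (ℕ.*-identityʳ i))
    (trans (sym (ℤ.pos-* a i)) (trans (cong +_ eq)
    (trans (ℤ.pos-* n b) (sym (ℤ.*-identityʳ (+ n ℤ.* + b))))))

lemma3p1 : ∀ {n : ℕ} (G : Graph n) → VertexTransitive G → (v : Fin n) →
    ∀ (i : ℕ) (1≤i : 1 ≤ i) → i ≤ n →
    (+ dₜ G i) / 1 ≡ _/_ (+ n) i {{>-nonZero 1≤i}} * ((+ dₜ∋ G v i) / 1)
lemma3p1 {n} G transitive v i 1≤i i≤n =
  a*i≡n*b⇒a≡n/i*b (dₜ G i) (dₜ∋ G v i) n i {{>-nonZero 1≤i}} (dₜ*i≡n*dₜ∋ G transitive v i)
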